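{- Let $q$ be a prime power, let $N\ge1$ and $r\ge1$ be integers, and let $\mathcal{B}=\mathcal{B}_1\cup\dots\cup\mathcal{B}_r$ be a cutting blocking set in $\mathrm{PG}(N,q)$. For each $i\in\{1,\dots,r\}$, let $\Gamma_i:=\langle\mathcal{B}_i\rangle\cong\mathrm{PG}(n_i,q)$ for some $n_i\le N$, and let $\mathcal{B}_i'\subseteq\Gamma_i$ be the isomorphic image of a cutting blocking set in $\mathrm{PG}(n_i,q)$. Then $\mathcal{B}':=\mathcal{B}_1'\cup\dots\cup\mathcal{B}_r'$ is a cutting blocking set in $\mathrm{PG}(N,q)$.
   Context: $\mathrm{PG}(N,q)$ is the $N$-dimensional projective space over $\mathbb{F}_q$ and $\langle\cdot\rangle$ denotes the projective span. A set $\mathcal{M}\subseteq\mathrm{PG}(N,q)$ ($N\ge1$) is a cutting blocking set if $\langle\mathcal{M}\cap H\rangle=H$ for every hyperplane $H$ of $\mathrm{PG}(N,q)$. In the degenerate case $N=0$, the only cutting blocking set of $\mathrm{PG}(0,q)$ is by convention the single point itself. "Isomorphic image" means the image under a projective isomorphism $\mathrm{PG}(n_i,q)\to\Gamma_i$. -}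

module Defs where

open import Algebra.Bundles using (CommutativeRing)
open import Algebra.Definitions using (Invertible)
open import Algebra.Morphism.Structures using (module RingMorphisms)
open import Data.Fin.Base using (Fin)
open import Data.Nat.Base using (ℕ; zero; suc; _^_; _≤_)
open import Data.Nat.Primality using (Prime)
open import Data.Product.Base using (Σ; ∃-syntax; _×_; _,_)
open import Data.Vec.Functional using (Vector)
open import Function.Bundles using (Inverse)
open import Level using (Level; Lift) renaming (_⊔_ to _⊔ˡ_; suc to lsuc)
open import Relation.Binary.Core using (Rel)
open import Relation.Binary.Definitions using (_Respects_)
open import Relation.Binary.PropositionalEquality using (_≡_) renaming (setoid to ≡-setoid)
open import Relation.Nullary.Negation using (¬_)
open import Relation.Unary using (Pred; _≐_)
import Algebra.Properties.Semiring.Sum as Sum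
import Data.Vec.Functional.Relation.Binary.Equality.Setoid as VecEq
import Relation.Binary.Reasoning.Setoid as SetoidReasoning

IsPrimePower : ℕ → Set
IsPrimePower q = ∃[ p ] ∃[ k ] Prime p × 1 ≤ k × q ≡ p ^ k

record FiniteField (c ℓ : Level) (q : ℕ) : Set (lsuc (c ⊔ˡ ℓ)) where
  field
    commutativeRing : CommutativeRing c ℓ
  open CommutativeRing commutativeRing public
  field
    1≉0         : ¬ (1# ≈ 0#)
    invertible  : ∀ a → ¬ (a ≈ 0#) → Invertible _≈_ 1# _*_ a
    enumeration : Inverse setoid (≡-setoid (Fin q))

module ProjectiveSpace {c ℓ : Level} {q : ℕ} (F : FiniteField c ℓ q) where

  open FiniteField F
  open Sum semiring using (sum; sum-cong-≋; *-distribˡ-sum)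
  open VecEq setoid using (_≋_)

  0ᵛ : ∀ {m} → Vector Carrier m
  0ᵛ _ = 0#

  infixl 6 _+ᵛ_
  _+ᵛ_ : ∀ {m} → Vector Carrier m → Vector Carrier m → Vector Carrier m
  (u +ᵛ v) i = u i + v i

  infixr 7 _·ᵛ_
  _·ᵛ_ : ∀ {m} → Carrier → Vector Carrier m → Vector Carrier m
  (a ·ᵛ v) i = a * v i

  infix 4 _∼_
  _∼_ : ∀ {m} → Rel (Vector Carrier m) (c ⊔ˡ ℓ)
  u ∼ v = ∃[ a ] ¬ (a ≈ 0#) × u ≋ a ·ᵛ v

  -- A point of PG(N,q), given by homogeneous coordinates; two points are
  -- equal when these are proportional (_≈ₚ_).
  record Point (N : ℕ) : Set (c ⊔ˡ ℓ) where
    field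
      coords  : Vector Carrier (suc N)
      nonzero : ¬ (coords ≋ 0ᵛ)
  open Point public

  infix 4 _≈ₚ_
  _≈ₚ_ : ∀ {N} → Rel (Point N) (c ⊔ˡ ℓ)
  P ≈ₚ Q = coords P ∼ coords Q

  record PointSet (N : ℕ) : Set (lsuc (c ⊔ˡ ℓ)) where
    field
      members  : Pred (Point N) (c ⊔ˡ ℓ)
      respects : members Respects _≈ₚ_
  open PointSet public

  infix 4 _∈ₚ_ _≐ₚ_
  _∈ₚ_ : ∀ {N} → Point N → PointSet N → Set (c ⊔ˡ ℓ)
  P ∈ₚ S = members S P

  _≐ₚ_ : ∀ {N} → PointSet N → PointSet N → Set (c ⊔ˡ ℓ)
  S ≐ₚ T = members S ≐ members T

  infixr 7 _∩ₚ_
  _∩ₚ_ : ∀ {N} → PointSet N → PointSet N → PointSet N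
  members  (S ∩ₚ T) P               = P ∈ₚ S × P ∈ₚ T
  respects (S ∩ₚ T) P≈Q (P∈S , P∈T) = respects S P≈Q P∈S , respects T P≈Q P∈T

  ⋃ₚ : ∀ {N r} → (Fin r → PointSet N) → PointSet N
  members  (⋃ₚ S) P              = ∃[ i ] P ∈ₚ S i
  respects (⋃ₚ S) P≈Q (i , P∈Sᵢ) = i , respects (S i) P≈Q P∈Sᵢ

  combination : ∀ {N k} → Vector Carrier k → Vector (Point N) k → Vector Carrier (suc N)
  combination a Ps i = sum (λ j → a j * coords (Ps j) i)

  Independent : ∀ {N k} → Vector (Point N) k → Set (c ⊔ˡ ℓ)
  Independent Ps = ∀ a → combination a Ps ≋ 0ᵛ → a ≋ 0ᵛ

  ∼-sym : ∀ {m} {u v : Vector Carrier m} → u ∼ v → v ∼ u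
  ∼-sym {u = u} {v} (a , a≉0 , u≋av) with invertible a a≉0
  ... | b , ba≈1 , _ = b , b≉0 , λ i → begin
      v i             ≈⟨ *-identityˡ (v i) ⟨
      1# * v i        ≈⟨ *-congʳ ba≈1 ⟨
      (b * a) * v i   ≈⟨ *-assoc b a (v i) ⟩
      b * (a * v i)   ≈⟨ *-congˡ (u≋av i) ⟨
      b * u i         ∎
    where
    open SetoidReasoning setoid
    b≉0 : ¬ (b ≈ 0#)
    b≉0 b≈0 = 1≉0 (trans (sym ba≈1) (trans (*-congʳ b≈0) (zeroˡ a)))

  ∼-trans : ∀ {m} {u v w : Vector Carrier m} → u ∼ v → v ∼ w → u ∼ w
  ∼-trans {w = w} (a , a≉0 , u≋av) (b , b≉0 , v≋bw) with invertible a a≉0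
  ... | a⁻¹ , a⁻¹a≈1 , _ =
    a * b , ab≉0 ,
    λ i → trans (u≋av i) (trans (*-congˡ (v≋bw i)) (sym (*-assoc a b (w i))))
    where
    open SetoidReasoning setoid
    ab≉0 : ¬ (a * b ≈ 0#)
    ab≉0 ab≈0 = b≉0 (begin
      b               ≈⟨ *-identityˡ b ⟨
      1# * b          ≈⟨ *-congʳ a⁻¹a≈1 ⟨
      (a⁻¹ * a) * b   ≈⟨ *-assoc a⁻¹ a b ⟩
      a⁻¹ * (a * b)   ≈⟨ *-congˡ ab≈0 ⟩
      a⁻¹ * 0#        ≈⟨ zeroʳ a⁻¹ ⟩
      0#              ∎)

  -- The projective span: all points whose coordinates are a linear
  -- combination of finitely many points of S.
  ⟨_⟩ : ∀ {N} → PointSet N → PointSet N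
  members ⟨ S ⟩ P =
    ∃[ k ] Σ (Vector (Point _) k) λ Ps →
      (∀ j → Ps j ∈ₚ S) × ∃[ a ] coords P ≋ combination a Ps
  respects ⟨ S ⟩ {P} {Q} P≈Q (k , Ps , Ps⊆S , a , P≋) with ∼-sym P≈Q
  ... | b , _ , Q≋bP = k , Ps , Ps⊆S , b ·ᵛ a , λ i → begin
    coords Q i                                  ≈⟨ Q≋bP i ⟩
    b * coords P i                              ≈⟨ *-congˡ (P≋ i) ⟩
    b * combination a Ps i                      ≈⟨ *-distribˡ-sum b (λ j → a j * coords (Ps j) i) ⟩
    sum (λ j → b * (a j * coords (Ps j) i))     ≈⟨ sum-cong-≋ (λ j → sym (*-assoc b (a j) (coords (Ps j) i))) ⟩
    combination (b ·ᵛ a) Ps i                   ∎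
    where open SetoidReasoning setoid

  -- A hyperplane of PG(N,q) is an (N−1)-dimensional projective subspace,
  -- i.e. one spanned by N independent points.
  IsHyperplane : ∀ {N} → PointSet N → Set (c ⊔ˡ ℓ)
  IsHyperplane {N} H =
    Σ (Vector (Point N) N) λ Ps →
      Independent Ps × members H ≐ (λ P → ∃[ a ] coords P ≋ combination a Ps)

  IsCuttingBlockingSet : ∀ {N} → PointSet N → Set (lsuc (c ⊔ˡ ℓ))
  IsCuttingBlockingSet {zero}  M = Lift (lsuc (c ⊔ˡ ℓ)) (∀ P → P ∈ₚ M)
  IsCuttingBlockingSet {suc N} M = ∀ H → IsHyperplane H → ⟨ M ∩ₚ H ⟩ ≐ₚ H

  -- A projective isomorphism PG(n,q) → Γ ⊆ PG(N,q): a map of points induced by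
  -- an injective semilinear map whose image is Γ.  Taking σ to be the identity
  -- gives the projectivities.
  record ProjectiveIsomorphism (n : ℕ) {N : ℕ} (Γ : PointSet N) : Set (c ⊔ˡ ℓ) where
    open RingMorphisms rawRing rawRing using (IsRingIsomorphism)
    field
      σ                 : Carrier → Carrier
      σ-isAutomorphism  : IsRingIsomorphism σ
      map               : Vector Carrier (suc n) → Vector Carrier (suc N)
      map-cong          : ∀ {u v} → u ≋ v → map u ≋ map v
      map-+             : ∀ u v → map (u +ᵛ v) ≋ map u +ᵛ map v
      map-·             : ∀ a v → map (a ·ᵛ v) ≋ σ a ·ᵛ map v
      map-injective     : ∀ {u v} → map u ≋ map v → u ≋ v
      map-onto          : members Γ ≐ (λ P → ∃[ Q ] coords P ∼ map (coords Q))

  image : ∀ {n N} {Γ : PointSet N} → ProjectiveIsomorphism n Γ → PointSet n → PointSet N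
  members (image f C) P = ∃[ Q ] Q ∈ₚ C × coords P ∼ ProjectiveIsomorphism.map f (coords Q)
  respects (image f C) P≈P′ (Q , Q∈C , P∼fQ) = Q , Q∈C , ∼-trans (∼-sym P≈P′) P∼fQ

{-# OPTIONS --safe #-}
-- Fix a hyperplane H.  For each i the vectors mapped into H by the semilinear
-- map of φᵢ form a subspace W with the exchange property: modulo W, any vector
-- outside W generates everything.  Such a W is a hyperplane or the whole space,
-- so (apart from the trivial case nᵢ = 0) each point of W lies on a hyperplane
-- contained in W, and hence in the span of the points of 𝓒ᵢ in W, as 𝓒ᵢ is
-- cutting.  Applying φᵢ puts every point of 𝓑ᵢ ∩ H into the span of 𝓑′ᵢ ∩ H,
-- and the points of the sets 𝓑ᵢ ∩ H span H.
--
-- The dimension theory needed (n + 1 independent vectors span the space of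
-- dimension n + 1) is a counting argument, since the field is finite.
module Submission where

open import Defs
open import Level using (Level; Lift; lift) renaming (_⊔_ to _⊔ˡ_)
open import Algebra.Morphism.Structures using (module RingMorphisms)
open import Data.Empty using (⊥-elim)
open import Data.Fin.Base using (Fin; zero; suc; punchIn; punchOut; combine; funToFin; finToFun)
open import Data.Fin.Properties using (_≟_; any?; all?; ¬∀⟶∃¬; injective⇒≤; inj⇒≟; punchIn-injective; punchInᵢ≢i; punchIn-punchOut; punchOut-injective; funToFin-finToFin; finToFun-funToFin)
open import Data.Nat.Base using (ℕ; zero; suc; _^_; _≤_)
open import Data.Nat.Properties using (1+n≰n)
open import Data.Product.Base using (Σ; ∃-syntax; _×_; _,_; proj₁; proj₂)
open import Data.Vec.Functional using (Vector; _∷_; updateAt; removeAt)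
open import Data.Vec.Functional.Properties using (updateAt-updates; updateAt-minimal)
open import Function.Base using (_∘_)
open import Function.Bundles using (Inverse)
open import Function.Definitions using (Injective; StrictlySurjective)
open import Function.Properties.Inverse using (Inverse⇒Injection)
open import Relation.Binary.Bundles using (Setoid)
open import Relation.Binary.Definitions using (_Respects_) renaming (Decidable to Decidable₂)
open import Relation.Binary.PropositionalEquality as ≡ using (_≡_; _≢_; _≗_) renaming (setoid to ≡-setoid)
open import Relation.Nullary.Decidable.Core using (Dec; yes; no; map′)
open import Relation.Nullary.Negation using (¬_; contradiction)
open import Relation.Unary using (Pred; Decidable; _⊆_)
import Algebra.Properties.Ring as RingProperties
import Algebra.Properties.Semiring.Sum as Sum
import Data.Vec.Functional.Relation.Binary.Equality.Setoid as VecEq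
import Relation.Binary.Reasoning.Setoid as SetoidReasoning

-- Injective self-maps of finite sets.

-- Pigeonhole: deleting a missed value `y` from the codomain would inject `Fin (suc n)` into
-- `Fin n`.
Fin-injective⇒surjective : ∀ {n} {f : Fin n → Fin n} →
  Injective _≡_ _≡_ f → StrictlySurjective _≡_ f
Fin-injective⇒surjective {suc n} {f} f-inj y with any? (λ x → f x ≟ y)
... | yes hit = hit
... | no miss = contradiction (injective⇒≤ avoid-inj) 1+n≰n
  where
  avoid : Fin (suc n) → Fin n
  avoid x = punchOut {i = y} {j = f x} (λ y≡fx → miss (x , ≡.sym y≡fx))
  avoid-inj : Injective _≡_ _≡_ avoid
  avoid-inj eq = f-inj (punchOut-injective {i = y} _ _ eq)

injective⇒surjective : ∀ {a ℓ n} {S : Setoid a ℓ} → Inverse S (≡-setoid (Fin n)) →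
  let open Setoid S in
  {f : Carrier → Carrier} → Injective _≈_ _≈_ f → (∀ {x y} → x ≈ y → f x ≈ f y) →
  StrictlySurjective _≈_ f
injective⇒surjective {S = S} enum {f} f-inj f-cong y =
  from (proj₁ preimage) , to-inj (proj₂ preimage)
  where
  open Setoid S
  open Inverse enum
  to-inj : Injective _≈_ _≡_ to
  to-inj {x} {z} eq = trans (sym (strictlyInverseʳ x)) (trans (from-cong eq) (strictlyInverseʳ z))
  from-inj : Injective _≡_ _≈_ from
  from-inj {i} {j} eq = ≡.trans (≡.sym (strictlyInverseˡ i)) (≡.trans (to-cong eq) (strictlyInverseˡ j))
  preimage : ∃[ i ] to (f (from i)) ≡ to y
  preimage = Fin-injective⇒surjective (λ eq → from-inj (f-inj (to-inj eq))) (to y)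

funToFin-cong : ∀ {m n} {f g : Fin m → Fin n} → f ≗ g → funToFin f ≡ funToFin g
funToFin-cong {zero}  f≗g = ≡.refl
funToFin-cong {suc m} f≗g = ≡.cong₂ combine (f≗g zero) (funToFin-cong (f≗g ∘ suc))

module LinearAlgebra {c ℓ : Level} {q : ℕ} (F : FiniteField c ℓ q) where

  open FiniteField F hiding (zero)
  open ProjectiveSpace F
  open RingProperties ring using (x∙y⁻¹≈ε⇒x≈y; -1*x≈-x)
  open Sum semiring using (sum; sum-cong-≋; *-distribˡ-sum; ∑-distrib-+; sum-remove; sum-replicate-zero)
  open VecEq setoid using (_≋_; ≋-refl; ≋-sym; ≋-trans; ≋-setoid)
  open SetoidReasoning setoid

  -- Finiteness of the field and of its coordinate spaces.

  _≈?_ : Decidable₂ _≈_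
  _≈?_ = inj⇒≟ (Inverse⇒Injection enumeration)

  -- Vectors are read as numerals with `m` digits in base `q`. Finiteness serves twice: to decide
  -- membership in a span by search, and to obtain spanning from independence by counting.
  vectorEnumeration : ∀ m → Inverse (≋-setoid m) (≡-setoid (Fin (q ^ m)))
  vectorEnumeration m = record
    { to        = encode
    ; from      = decode
    ; to-cong   = encode-cong
    ; from-cong = λ {i} {j} i≡j → decode-cong i≡j
    ; inverse   = (λ {i} {v} v≋ → ≡.trans (encode-cong v≋) (encode-decode i))
                , (λ {v} {i} i≡ → ≋-trans (decode-cong i≡) (decode-encode v))
    }
    where
    open Inverse enumeration
    encode : Vector Carrier m → Fin (q ^ m)
    encode v = funToFin (to ∘ v)
    decode : Fin (q ^ m) → Vector Carrier m
    decode i = from ∘ finToFun {q} {m} i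
    encode-cong : ∀ {u v} → u ≋ v → encode u ≡ encode v
    encode-cong u≋v = funToFin-cong (to-cong ∘ u≋v)
    decode-cong : ∀ {i j} → i ≡ j → decode i ≋ decode j
    decode-cong ≡.refl = ≋-refl
    encode-decode : ∀ i → encode (decode i) ≡ i
    encode-decode i = ≡.trans
      (funToFin-cong {f = to ∘ decode i} {finToFun {q} {m} i} (strictlyInverseˡ ∘ finToFun {q} {m} i))
      (funToFin-finToFin {m} i)
    decode-encode : ∀ v → decode (encode v) ≋ v
    decode-encode v i = trans (from-cong (finToFun-funToFin (to ∘ v) i)) (strictlyInverseʳ (v i))

  -- Linear combinations and unit vectors.

  sum-zero : ∀ {n} {f : Vector Carrier n} → (∀ i → f i ≈ 0#) → sum f ≈ 0#
  sum-zero {n} f≈0 = trans (sum-cong-≋ f≈0) (sum-replicate-zero n)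

  sum-single : ∀ {n} j {f : Vector Carrier n} → (∀ i → i ≢ j → f i ≈ 0#) → sum f ≈ f j
  sum-single {suc n} j {f} f≈0 = begin
    sum f                       ≈⟨ sum-remove f ⟩
    f j + sum (removeAt f j)    ≈⟨ +-congˡ (sum-zero (λ i → f≈0 _ (punchInᵢ≢i j i))) ⟩
    f j + 0#                    ≈⟨ +-identityʳ (f j) ⟩
    f j                         ∎

  comb : ∀ {k m} → Vector Carrier k → Vector (Vector Carrier m) k → Vector Carrier m
  comb a vs i = sum (λ j → a j * vs j i)

  comb-cong : ∀ {k m} {a b : Vector Carrier k} (vs : Vector (Vector Carrier m) k) →
    a ≋ b → comb a vs ≋ comb b vs
  comb-cong vs a≋b i = sum-cong-≋ (λ j → *-congʳ (a≋b j))

  comb-0 : ∀ {k m} (vs : Vector (Vector Carrier m) k) → comb 0ᵛ vs ≋ 0ᵛ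
  comb-0 vs i = sum-zero (λ j → zeroˡ (vs j i))

  comb-+ : ∀ {k m} (a b : Vector Carrier k) (vs : Vector (Vector Carrier m) k) →
    comb (a +ᵛ b) vs ≋ comb a vs +ᵛ comb b vs
  comb-+ a b vs i = trans
    (sum-cong-≋ (λ j → distribʳ (vs j i) (a j) (b j)))
    (∑-distrib-+ (λ j → a j * vs j i) (λ j → b j * vs j i))

  comb-· : ∀ {k m} x (a : Vector Carrier k) (vs : Vector (Vector Carrier m) k) →
    comb (x ·ᵛ a) vs ≋ x ·ᵛ comb a vs
  comb-· x a vs i = trans
    (sum-cong-≋ (λ j → *-assoc x (a j) (vs j i)))
    (sym (*-distribˡ-sum x (λ j → a j * vs j i)))

  infixl 6 _-ᵛ_
  _-ᵛ_ : ∀ {m} → Vector Carrier m → Vector Carrier m → Vector Carrier m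
  u -ᵛ v = u +ᵛ (- 1#) ·ᵛ v

  -ᵛ-zero⇒≋ : ∀ {m} {u v : Vector Carrier m} → u -ᵛ v ≋ 0ᵛ → u ≋ v
  -ᵛ-zero⇒≋ {u = u} {v} u-v≋0 i =
    x∙y⁻¹≈ε⇒x≈y (u i) (v i) (trans (+-congˡ (sym (-1*x≈-x (v i)))) (u-v≋0 i))

  ≋⇒-ᵛ-zero : ∀ {m} {u v : Vector Carrier m} → u ≋ v → u -ᵛ v ≋ 0ᵛ
  ≋⇒-ᵛ-zero {u = u} {v} u≋v i =
    trans (+-cong (u≋v i) (-1*x≈-x (v i))) (-‿inverseʳ (v i))

  +-·-cancel : ∀ {m} x (u v : Vector Carrier m) → (x ·ᵛ u +ᵛ v) +ᵛ (- x) ·ᵛ u ≋ v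
  +-·-cancel x u v i = begin
    (x * u i + v i) + - x * u i    ≈⟨ +-congʳ (+-comm (x * u i) (v i)) ⟩
    (v i + x * u i) + - x * u i    ≈⟨ +-assoc (v i) (x * u i) (- x * u i) ⟩
    v i + (x * u i + - x * u i)    ≈⟨ +-congˡ (distribʳ (u i) x (- x)) ⟨
    v i + (x + - x) * u i          ≈⟨ +-congˡ (*-congʳ (-‿inverseʳ x)) ⟩
    v i + 0# * u i                 ≈⟨ +-congˡ (zeroˡ (u i)) ⟩
    v i + 0#                       ≈⟨ +-identityʳ (v i) ⟩
    v i                            ∎

  e : ∀ {m} → Fin m → Vector Carrier m
  e j = updateAt 0ᵛ j (λ _ → 1#)

  e-diagonal : ∀ {m} (j : Fin m) → e j j ≈ 1#
  e-diagonal j = reflexive (updateAt-updates j 0ᵛ)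

  e-offDiagonal : ∀ {m} {i j : Fin m} → i ≢ j → e j i ≈ 0#
  e-offDiagonal {i = i} {j} i≢j = reflexive (updateAt-minimal i j 0ᵛ i≢j)

  ≋-comb-e : ∀ {m} (v : Vector Carrier m) → v ≋ comb v e
  ≋-comb-e v i = sym (begin
    sum (λ j → v j * e j i)   ≈⟨ sum-single i (λ j j≢i → trans (*-congˡ (e-offDiagonal (j≢i ∘ ≡.sym))) (zeroʳ (v j))) ⟩
    v i * e i i               ≈⟨ *-congˡ (e-diagonal i) ⟩
    v i * 1#                  ≈⟨ *-identityʳ (v i) ⟩
    v i                       ∎)

  -- Subspaces, linear independence and the exchange property.

  record IsSubspace {m w} (W : Pred (Vector Carrier m) w) : Set (c ⊔ˡ ℓ ⊔ˡ w) where
    field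
      resp     : W Respects _≋_
      0-closed : W 0ᵛ
      +-closed : ∀ {u v} → W u → W v → W (u +ᵛ v)
      ·-closed : ∀ x {v} → W v → W (x ·ᵛ v)

    comb-closed : ∀ {k} a (vs : Vector (Vector Carrier m) k) → (∀ j → W (vs j)) → W (comb a vs)
    comb-closed {zero}  a vs vs∈W = 0-closed
    comb-closed {suc k} a vs vs∈W =
      +-closed (·-closed (a zero) (vs∈W zero)) (comb-closed (a ∘ suc) (vs ∘ suc) (vs∈W ∘ suc))

    ·-cancel : ∀ {x v} → ¬ (x ≈ 0#) → W (x ·ᵛ v) → W v
    ·-cancel {x} {v} x≉0 xv∈W with invertible x x≉0
    ... | y , yx≈1 , _ = resp
      (λ i → trans (sym (*-assoc y x (v i))) (trans (*-congʳ yx≈1) (*-identityˡ (v i))))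
      (·-closed y xv∈W)

    ∼-closed : ∀ {u v} → u ∼ v → W u → W v
    ∼-closed (x , x≉0 , u≋xv) u∈W = ·-cancel x≉0 (resp u≋xv u∈W)

  -- For a subspace `W` this says that the quotient by `W` has dimension at most one. Phrased
  -- without dimensions, it passes to preimages under semilinear maps, where `W` may become the
  -- whole space.
  Exchange : ∀ {m w} → Pred (Vector Carrier m) w → Set (c ⊔ˡ w)
  Exchange W = ∀ u → ¬ W u → ∀ v → ∃[ x ] W (v +ᵛ x ·ᵛ u)

  LinSpan : ∀ {k m} → Vector (Vector Carrier m) k → Pred (Vector Carrier m) (c ⊔ˡ ℓ)
  LinSpan vs v = ∃[ a ] v ≋ comb a vs

  LinSpan-isSubspace : ∀ {k m} (vs : Vector (Vector Carrier m) k) → IsSubspace (LinSpan vs)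
  LinSpan-isSubspace vs = record
    { resp     = λ { u≋v (a , u≋) → a , ≋-trans (≋-sym u≋v) u≋ }
    ; 0-closed = 0ᵛ , ≋-sym (comb-0 vs)
    ; +-closed = λ { (a , u≋) (b , v≋) → a +ᵛ b ,
        λ i → trans (+-cong (u≋ i) (v≋ i)) (sym (comb-+ a b vs i)) }
    ; ·-closed = λ { x (a , v≋) → x ·ᵛ a ,
        λ i → trans (*-congˡ (v≋ i)) (sym (comb-· x a vs i)) }
    }

  -- Exhaustive search through the finitely many coefficient vectors.
  LinSpan? : ∀ {k m} (vs : Vector (Vector Carrier m) k) → Decidable (LinSpan vs)
  LinSpan? {k} vs v = map′
    (λ { (i , v≋) → from i , v≋ })
    (λ { (a , v≋) → to a , ≋-trans v≋ (comb-cong vs (≋-sym (strictlyInverseʳ a))) })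
    (any? (λ i → all? (λ j → v j ≈? comb (from i) vs j)))
    where open Inverse (vectorEnumeration k)

  LinIndependent : ∀ {k m} → Vector (Vector Carrier m) k → Set (c ⊔ˡ ℓ)
  LinIndependent vs = ∀ a → comb a vs ≋ 0ᵛ → a ≋ 0ᵛ

  -- As there are as many vectors as coordinates, `a ↦ comb a vs` maps a finite space to itself. It
  -- is linear with trivial kernel, hence injective, hence surjective.
  independent⇒spanning : ∀ {m} {vs : Vector (Vector Carrier m) m} →
    LinIndependent vs → ∀ v → LinSpan vs v
  independent⇒spanning {m} {vs} ind v =
    let a , eq = injective⇒surjective (vectorEnumeration m) {f = λ a → comb a vs} inj (comb-cong vs) v
    in  a , ≋-sym eq
    where
    inj : Injective _≋_ _≋_ (λ a → comb a vs)
    inj {a} {b} eq = -ᵛ-zero⇒≋ (ind (a -ᵛ b) (λ i → begin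
      comb (a -ᵛ b) vs i                         ≈⟨ comb-+ a ((- 1#) ·ᵛ b) vs i ⟩
      comb a vs i + comb ((- 1#) ·ᵛ b) vs i      ≈⟨ +-congˡ (comb-· (- 1#) b vs i) ⟩
      (comb a vs -ᵛ comb b vs) i                 ≈⟨ ≋⇒-ᵛ-zero eq i ⟩
      0#                                         ∎))

  -- In a vanishing combination, a nonzero coefficient of `u` would let one solve for `u` in terms
  -- of `vs`; with that coefficient zero, the independence of `vs` takes care of the rest.
  ∷-independent : ∀ {k m} {u : Vector Carrier m} {vs : Vector (Vector Carrier m) k} →
    LinIndependent vs → ¬ LinSpan vs u → LinIndependent (u ∷ vs)
  ∷-independent {u = u} {vs} ind u∉ a eq with a zero ≈? 0#
  ... | no a₀≉0 = ⊥-elim (u∉ (·-cancel a₀≉0 (resp shift (·-closed (- 1#) (a ∘ suc , ≋-refl)))))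
    where
    open IsSubspace (LinSpan-isSubspace vs)
    shift : (- 1#) ·ᵛ comb (a ∘ suc) vs ≋ a zero ·ᵛ u
    shift i = begin
      - 1# * t                     ≈⟨ +-identityˡ _ ⟨
      0# + - 1# * t                ≈⟨ +-congʳ (eq i) ⟨
      (a zero * u i + t) + - 1# * t ≈⟨ +-assoc _ _ _ ⟩
      a zero * u i + (t + - 1# * t) ≈⟨ +-congˡ (≋⇒-ᵛ-zero {u = comb (a ∘ suc) vs} ≋-refl i) ⟩
      a zero * u i + 0#            ≈⟨ +-identityʳ _ ⟩
      a zero * u i                 ∎
      where t = comb (a ∘ suc) vs i
  ... | yes a₀≈0 = λ { zero → a₀≈0 ; (suc j) → ind (a ∘ suc) tail≋0 j }
    where
    tail≋0 : comb (a ∘ suc) vs ≋ 0ᵛ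
    tail≋0 i = begin
      comb (a ∘ suc) vs i                     ≈⟨ +-identityˡ _ ⟨
      0# + comb (a ∘ suc) vs i                ≈⟨ +-congʳ (trans (*-congʳ a₀≈0) (zeroˡ (u i))) ⟨
      a zero * u i + comb (a ∘ suc) vs i      ≈⟨ eq i ⟩
      0#                                      ∎

  -- Adjoining `u` to `vs` gives a basis of the whole space. Expanding `v` in it and cancelling the
  -- `u` term leaves a combination of `vs`.
  LinSpan-exchange : ∀ {n} {vs : Vector (Vector Carrier (suc n)) n} →
    LinIndependent vs → Exchange (LinSpan vs)
  LinSpan-exchange {vs = vs} ind u u∉ v =
    let b , v≋ = independent⇒spanning {vs = u ∷ vs} (∷-independent {vs = vs} ind u∉) v
    in  - b zero , b ∘ suc , λ i →
          trans (+-congʳ (v≋ i)) (+-·-cancel (b zero) u (comb (b ∘ suc) vs) i)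

  -- Hyperplanes obtained from subspaces.

  fromSubspace : ∀ {n} {W : Pred (Vector Carrier (suc n)) (c ⊔ˡ ℓ)} → IsSubspace W → PointSet n
  fromSubspace {W = W} sub = record
    { members  = W ∘ coords
    ; respects = IsSubspace.∼-closed sub
    }

  -- The basis of W consists of the vectors e i + xᵢ e j ∈ W for i ≠ j.
  exchange⇒hyperplane : ∀ {n} {W : Pred (Vector Carrier (suc n)) (c ⊔ˡ ℓ)} (sub : IsSubspace W) j →
    ¬ W (e j) → (∀ v → ∃[ x ] W (v +ᵛ x ·ᵛ e j)) → IsHyperplane (fromSubspace sub)
  exchange⇒hyperplane {n} {W} sub j eⱼ∉W exch =
    points , independent , (λ {P} → spans {P}) , (λ {P} → spanned {P})
    where
    open IsSubspace sub

    basis : Vector (Vector Carrier (suc n)) n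
    basis i = e (punchIn j i) +ᵛ proj₁ (exch (e (punchIn j i))) ·ᵛ e j

    basis∈W : ∀ i → W (basis i)
    basis∈W i = proj₂ (exch (e (punchIn j i)))

    basis-at : ∀ i l → basis i (punchIn j l) ≈ e (punchIn j i) (punchIn j l)
    basis-at i l = trans
      (+-congˡ (trans (*-congˡ (e-offDiagonal (punchInᵢ≢i j l))) (zeroʳ _)))
      (+-identityʳ _)

    basis-diagonal : ∀ i → basis i (punchIn j i) ≈ 1#
    basis-diagonal i = trans (basis-at i i) (e-diagonal (punchIn j i))

    -- Away from the pivot `j` the vectors of `basis` form an identity matrix, so coefficients
    -- reappear as coordinates. This gives independence and dictates the coefficients in `spans`.
    comb-basis : ∀ a l → comb a basis (punchIn j l) ≈ a l
    comb-basis a l = begin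
      comb a basis (punchIn j l)     ≈⟨ sum-single l (λ i i≢l → trans (*-congˡ (trans (basis-at i l)
                                          (e-offDiagonal (i≢l ∘ ≡.sym ∘ punchIn-injective j l i)))) (zeroʳ (a i))) ⟩
      a l * basis l (punchIn j l)    ≈⟨ *-congˡ (basis-diagonal l) ⟩
      a l * 1#                       ≈⟨ *-identityʳ (a l) ⟩
      a l                            ∎

    points : Vector (Point n) n
    points i = record
      { coords  = basis i
      ; nonzero = λ basis≋0 → 1≉0 (trans (sym (basis-diagonal i)) (basis≋0 (punchIn j i)))
      }

    independent : Independent points
    independent a eq l = trans (sym (comb-basis a l)) (eq (punchIn j l))

    -- Such a `v` is a multiple of `e j`; were the factor nonzero, `e j` would lie in `W`. So
    -- vectors of `W` are determined by their coordinates off the pivot.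
    off-pivot-zero : ∀ v → W v → (∀ l → v (punchIn j l) ≈ 0#) → v ≋ 0ᵛ
    off-pivot-zero v v∈W v≈0 = at-pivot (v j ≈? 0#)
      where
      elsewhere : ∀ {i} → j ≢ i → v i ≈ 0#
      elsewhere j≢i = trans (reflexive (≡.cong v (≡.sym (punchIn-punchOut j≢i)))) (v≈0 (punchOut j≢i))
      v≋vⱼeⱼ : v ≋ v j ·ᵛ e j
      v≋vⱼeⱼ i with j ≟ i
      ... | yes ≡.refl = sym (trans (*-congˡ (e-diagonal j)) (*-identityʳ (v j)))
      ... | no j≢i = trans (elsewhere j≢i)
        (sym (trans (*-congˡ (e-offDiagonal (j≢i ∘ ≡.sym))) (zeroʳ (v j))))
      at-pivot : Dec (v j ≈ 0#) → v ≋ 0ᵛ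
      at-pivot (yes vⱼ≈0) i = trans (v≋vⱼeⱼ i) (trans (*-congʳ vⱼ≈0) (zeroˡ (e j i)))
      at-pivot (no vⱼ≉0) = ⊥-elim (eⱼ∉W (·-cancel vⱼ≉0 (resp v≋vⱼeⱼ v∈W)))

    -- Copying the off-pivot coordinates of `P` as coefficients gives a combination that agrees with
    -- `P` there; the difference lies in `W`, so `off-pivot-zero` applies.
    spans : ∀ {P} → W (coords P) → LinSpan basis (coords P)
    spans {P} P∈W = a , -ᵛ-zero⇒≋ (off-pivot-zero (coords P -ᵛ comb a basis)
      (+-closed P∈W (·-closed (- 1#) (comb-closed a basis basis∈W)))
      (λ l → trans (+-congˡ (*-congˡ (comb-basis a l)))
                   (≋⇒-ᵛ-zero {u = a} ≋-refl l)))
      where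
      a : Vector Carrier n
      a l = coords P (punchIn j l)

    spanned : ∀ {P} → LinSpan basis (coords P) → W (coords P)
    spanned (a , eq) = resp (≋-sym eq) (comb-closed a basis basis∈W)

  -- Where `Q` has a nonzero coordinate `p`, fix the ratio of another coordinate `j` to it at the
  -- value taken by `Q`. This linear equation holds at `Q` and fails at `e j`.
  hyperplane-through : ∀ {n} (Q : Point (suc n)) → Σ (PointSet (suc n)) λ H → IsHyperplane H × Q ∈ₚ H
  hyperplane-through {n} Q with ¬∀⟶∃¬ _ _ (λ i → coords Q i ≈? 0#) (nonzero Q)
  ... | p , Qₚ≉0 with invertible (coords Q p) Qₚ≉0
  ... | y , _ , Qₚy≈1 = fromSubspace sub , exchange⇒hyperplane sub j eⱼ∉W exch , lift Q∈W
    where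
    -- Any index other than `p` would do; one exists because the vectors have at least two
    -- coordinates.
    j = punchIn p zero
    t = y * coords Q j
    W : Pred (Vector Carrier (suc (suc n))) (c ⊔ˡ ℓ)
    W v = Lift (c ⊔ˡ ℓ) (v j ≈ v p * t)
    sub : IsSubspace W
    sub = record
      { resp     = λ { u≋v (lift eq) → lift (trans (sym (u≋v j)) (trans eq (*-congʳ (u≋v p)))) }
      ; 0-closed = lift (sym (zeroˡ t))
      ; +-closed = λ { (lift eq₁) (lift eq₂) → lift (trans (+-cong eq₁ eq₂) (sym (distribʳ t _ _))) }
      ; ·-closed = λ { x (lift eq) → lift (trans (*-congˡ eq) (sym (*-assoc x _ t))) }
      }
    eⱼₚ≈0 : e j p ≈ 0#
    eⱼₚ≈0 = e-offDiagonal (punchInᵢ≢i p zero ∘ ≡.sym)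
    eⱼ∉W : ¬ W (e j)
    eⱼ∉W (lift eq) = 1≉0 (trans (sym (e-diagonal j)) (trans eq (trans (*-congʳ eⱼₚ≈0) (zeroˡ t))))
    exch : ∀ v → ∃[ x ] W (v +ᵛ x ·ᵛ e j)
    -- Adding a multiple of `e j` leaves coordinate `p` alone, so `x` is found by solving the
    -- equation for coordinate `j`.
    exch v = x , lift (begin
      v j + x * e j j             ≈⟨ +-congˡ (trans (*-congˡ (e-diagonal j)) (*-identityʳ x)) ⟩
      v j + (- v j + v p * t)     ≈⟨ +-assoc _ _ _ ⟨
      (v j + - v j) + v p * t     ≈⟨ +-congʳ (-‿inverseʳ (v j)) ⟩
      0# + v p * t                ≈⟨ +-identityˡ _ ⟩
      v p * t                     ≈⟨ *-congʳ (+-identityʳ (v p)) ⟨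
      (v p + 0#) * t              ≈⟨ *-congʳ (+-congˡ (trans (*-congˡ eⱼₚ≈0) (zeroʳ x))) ⟨
      (v p + x * e j p) * t       ∎)
      where x = - v j + v p * t
    Q∈W : coords Q j ≈ coords Q p * t
    Q∈W = begin
      coords Q j                      ≈⟨ *-identityˡ _ ⟨
      1# * coords Q j                 ≈⟨ *-congʳ Qₚy≈1 ⟨
      (coords Q p * y) * coords Q j   ≈⟨ *-assoc _ _ _ ⟩
      coords Q p * t                  ∎

  -- If `W` contains all unit vectors it is the whole space, and any hyperplane through `Q` serves.
  -- Otherwise some `e j` lies outside, and exchange at `e j` makes `W` itself a hyperplane.
  hyperplane-within : ∀ {n} {W : Pred (Vector Carrier (suc (suc n))) (c ⊔ˡ ℓ)} →
    IsSubspace W → Decidable W → Exchange W → (Q : Point (suc n)) → W (coords Q) →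
    Σ (PointSet (suc n)) λ H → IsHyperplane H × (∀ {P} → P ∈ₚ H → W (coords P)) × Q ∈ₚ H
  hyperplane-within sub W? exch Q Q∈W with all? (λ j → W? (e j))
  ... | yes e∈W =
    let H , isHyp , Q∈H = hyperplane-through Q
    in  H , isHyp , (λ {P} _ → resp (≋-sym (≋-comb-e (coords P))) (comb-closed (coords P) e e∈W)) , Q∈H
    where open IsSubspace sub
  ... | no ¬e∈W =
    let j , eⱼ∉W = ¬∀⟶∃¬ _ _ (λ j → W? (e j)) ¬e∈W
    in  fromSubspace sub , exchange⇒hyperplane sub j eⱼ∉W (exch (e j) eⱼ∉W) , (λ P∈W → P∈W) , Q∈W

  -- Linear spans of point sets.

  -- The cone over `⟨ S ⟩` together with the zero vector, so that it is a linear subspace. At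
  -- `coords P` it unfolds to membership of `P` in `⟨ S ⟩`, and the two are used interchangeably.
  Span : ∀ {N} → PointSet N → Pred (Vector Carrier (suc N)) (c ⊔ˡ ℓ)
  Span {N} S v = ∃[ k ] Σ (Vector (Point N) k) λ Ps →
    (∀ j → Ps j ∈ₚ S) × ∃[ a ] v ≋ combination a Ps

  Span-least : ∀ {N w} {S : PointSet N} {W : Pred (Vector Carrier (suc N)) w} → IsSubspace W →
    (∀ P → P ∈ₚ S → W (coords P)) → Span S ⊆ W
  Span-least sub S⊆W (k , Ps , Ps∈S , a , v≋) =
    resp (≋-sym v≋) (comb-closed a (coords ∘ Ps) (λ j → S⊆W (Ps j) (Ps∈S j)))
    where open IsSubspace sub

  Span-∷ : ∀ {N} (S : PointSet N) x {P v} → P ∈ₚ S → Span S v → Span S (x ·ᵛ coords P +ᵛ v)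
  Span-∷ S x {P} P∈S (k , Ps , Ps∈S , a , v≋) =
    suc k , P ∷ Ps , (λ { zero → P∈S ; (suc j) → Ps∈S j }) , x ∷ a , λ i → +-congˡ (v≋ i)

  Span-isSubspace : ∀ {N} (S : PointSet N) → IsSubspace (Span S)
  Span-isSubspace S = record
    { resp     = resp
    ; 0-closed = zero , (λ ()) , (λ ()) , 0ᵛ , ≋-refl
    ; +-closed = λ { (k , Ps , Ps∈S , a , u≋) v∈ →
        resp (λ i → +-congʳ (sym (u≋ i))) (comb-+-closed Ps Ps∈S a v∈) }
    ; ·-closed = λ { x (k , Ps , Ps∈S , a , v≋) →
        k , Ps , Ps∈S , x ·ᵛ a , λ i → trans (*-congˡ (v≋ i)) (sym (comb-· x a (coords ∘ Ps) i)) }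
    }
    where
    resp : Span S Respects _≋_
    resp u≋v (k , Ps , Ps∈S , a , u≋) = k , Ps , Ps∈S , a , ≋-trans (≋-sym u≋v) u≋
    -- The points of the left combination are prepended one at a time to the list that witnesses
    -- `v`.
    comb-+-closed : ∀ {k} Ps → (∀ j → Ps j ∈ₚ S) → ∀ (a : Vector Carrier k) {v} →
      Span S v → Span S (combination a Ps +ᵛ v)
    comb-+-closed {zero}  Ps Ps∈S a {v} v∈ = resp (λ i → sym (+-identityˡ (v i))) v∈
    comb-+-closed {suc k} Ps Ps∈S a v∈ = resp (λ i → sym (+-assoc _ _ _))
      (Span-∷ S (a zero) (Ps∈S zero) (comb-+-closed (Ps ∘ suc) (Ps∈S ∘ suc) (a ∘ suc) v∈))

  ∈ₚ⇒Span : ∀ {N} (S : PointSet N) {P} → P ∈ₚ S → Span S (coords P)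
  ∈ₚ⇒Span S {P} P∈S = resp
    (λ i → trans (+-identityʳ _) (*-identityˡ (coords P i)))
    (Span-∷ S 1# P∈S 0-closed)
    where open IsSubspace (Span-isSubspace S)

  -- Cutting blocking sets and subspaces with exchange.

  -- `Q` lies on a hyperplane `H` inside `W`, hence in the span of `C ∩ₚ H`, whose points all belong
  -- to `U`. Leaving `U` arbitrary allows it to be the preimage of a span in a larger space.
  cutting-induction : ∀ {n u} {C : PointSet n} → IsCuttingBlockingSet C →
    {W : Pred (Vector Carrier (suc n)) (c ⊔ˡ ℓ)} → IsSubspace W → Decidable W → Exchange W →
    {U : Pred (Vector Carrier (suc n)) u} → IsSubspace U →
    (∀ T → T ∈ₚ C → W (coords T) → U (coords T)) →
    ∀ Q → W (coords Q) → U (coords Q)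
  -- In `PG(0,q)` hyperplanes are empty, so none passes through `Q`; the convention that `C`
  -- contains the only point is used instead.
  cutting-induction {zero}  (lift all∈C) _ _ _ _ C∩W⊆U Q Q∈W = C∩W⊆U Q (all∈C Q) Q∈W
  cutting-induction {suc n} {C = C} cut subW W? exch subU C∩W⊆U Q Q∈W =
    let H , isHyp , H⊆W , Q∈H = hyperplane-within subW W? exch Q Q∈W
    in  Span-least {S = C ∩ₚ H} subU (λ { T (T∈C , T∈H) → C∩W⊆U T T∈C (H⊆W {T} T∈H) })
          (proj₂ (cut H isHyp) {Q} Q∈H)

  -- Transfer along a projective isomorphism.

  module Pullback {n N} {Γ : PointSet N} (φ : ProjectiveIsomorphism n Γ) where

    open ProjectiveIsomorphism φ
    open RingMorphisms.IsRingIsomorphism σ-isAutomorphism using (0#-homo; surjective)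

    map-0 : map 0ᵛ ≋ 0ᵛ
    map-0 i = begin
      map 0ᵛ i               ≈⟨ map-cong (λ j → sym (zeroˡ 0#)) i ⟩
      map (0# ·ᵛ 0ᵛ) i       ≈⟨ map-· 0# 0ᵛ i ⟩
      σ 0# * map 0ᵛ i        ≈⟨ *-congʳ 0#-homo ⟩
      0# * map 0ᵛ i          ≈⟨ zeroˡ _ ⟩
      0#                     ∎

    mapPoint : Point n → Point N
    mapPoint Q = record
      { coords  = map (coords Q)
      ; nonzero = λ map≋0 → nonzero Q (map-injective (≋-trans map≋0 (≋-sym map-0)))
      }

    pullback-isSubspace : ∀ {w} {V : Pred (Vector Carrier (suc N)) w} →
      IsSubspace V → IsSubspace (V ∘ map)
    pullback-isSubspace sub = record
      { resp     = λ u≋v → resp (map-cong u≋v)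
      ; 0-closed = resp (≋-sym map-0) 0-closed
      ; +-closed = λ {u} {v} u∈ v∈ → resp (≋-sym (map-+ u v)) (+-closed u∈ v∈)
      ; ·-closed = λ x {v} v∈ → resp (≋-sym (map-· x v)) (·-closed (σ x) v∈)
      }
      where open IsSubspace sub

    -- The scalar `y` given by exchange in the target must have the form `σ x`; surjectivity of the
    -- automorphism `σ` supplies `x`.
    pullback-exchange : ∀ {w} {V : Pred (Vector Carrier (suc N)) w} →
      IsSubspace V → Exchange V → Exchange (V ∘ map)
    pullback-exchange sub exch u u∉ v =
      let y , v+yu∈ = exch (map u) u∉ (map v)
          x , σ≈y = surjective y
      in  x , IsSubspace.resp sub (λ i → sym (begin
        map (v +ᵛ x ·ᵛ u) i             ≈⟨ map-+ v (x ·ᵛ u) i ⟩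
        map v i + map (x ·ᵛ u) i        ≈⟨ +-congˡ (map-· x u i) ⟩
        map v i + σ x * map u i         ≈⟨ +-congˡ (*-congʳ (σ≈y refl)) ⟩
        map v i + y * map u i           ∎)) v+yu∈

    -- Pull `V` and `U` back along `map` and apply `cutting-induction` to `C`. A point of `Γ` is the
    -- image of some `Q` up to a scalar, which subspaces ignore.
    image-cutting : ∀ {C : PointSet n} → IsCuttingBlockingSet C →
      {V : Pred (Vector Carrier (suc N)) (c ⊔ˡ ℓ)} → IsSubspace V → Decidable V → Exchange V →
      {U : Pred (Vector Carrier (suc N)) (c ⊔ˡ ℓ)} → IsSubspace U →
      (∀ P → P ∈ₚ image φ C → V (coords P) → U (coords P)) →
      ∀ P → P ∈ₚ Γ → V (coords P) → U (coords P)
    image-cutting cut {V} subV V? exch {U} subU image∩V⊆U P P∈Γ P∈V =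
      let Q , P∼Q = proj₁ map-onto {P} P∈Γ
      in  IsSubspace.∼-closed subU (∼-sym P∼Q)
            (cutting-induction cut (pullback-isSubspace subV) (V? ∘ map) (pullback-exchange subV exch)
              (pullback-isSubspace subU)
              (λ T T∈C T∈V → image∩V⊆U (mapPoint T) (T , T∈C , ∼-refl) T∈V)
              Q (IsSubspace.∼-closed subV P∼Q P∈V))
      where
      ∼-refl : ∀ {m} {v : Vector Carrier m} → v ∼ v
      ∼-refl {v = v} = 1# , 1≉0 , λ i → sym (*-identityˡ (v i))

proposition4p5 : ∀ {c ℓ : Level} (q : ℕ) → IsPrimePower q → (F : FiniteField c ℓ q) →
    let open ProjectiveSpace F in
    (N r : ℕ) → 1 ≤ N → 1 ≤ r →
    (𝓑 : Fin r → PointSet N) → IsCuttingBlockingSet (⋃ₚ 𝓑) →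
    (n : Fin r → ℕ) → (∀ i → n i ≤ N) →
    (φ : ∀ i → ProjectiveIsomorphism (n i) ⟨ 𝓑 i ⟩) →
    (𝓒 : ∀ i → PointSet (n i)) → (∀ i → IsCuttingBlockingSet (𝓒 i)) →
    (𝓑′ : Fin r → PointSet N) → (∀ i → 𝓑′ i ≐ₚ image (φ i) (𝓒 i)) →
    IsCuttingBlockingSet (⋃ₚ 𝓑′)
proposition4p5 q _ F (suc N) r _ _ 𝓑 cut n _ φ 𝓒 𝓒-cut 𝓑′ 𝓑′≐ H isHyp@(Ps , ind , H⊆V , V⊆H) =
  -- The span stays inside `H` because `H` consists of the points of the subspace spanned by `Ps`.
  (λ {P} P∈⟨𝓑′∩H⟩ → V⊆H {P}
    (Span-least {S = ⋃ₚ 𝓑′ ∩ₚ H} V-isSubspace (λ R R∈ → H⊆V {R} (proj₂ R∈)) P∈⟨𝓑′∩H⟩)) ,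
  -- As `⋃ₚ 𝓑` is cutting, `P` is in the span of its points on `H`; it remains to place those in the
  -- span of `⋃ₚ 𝓑′ ∩ₚ H`.
  (λ {P} P∈H → Span-least {S = ⋃ₚ 𝓑 ∩ₚ H} U-isSubspace 𝓑∩H⊆U (proj₂ (cut H isHyp) {P} P∈H))
  where
  open ProjectiveSpace F
  open LinearAlgebra F
  V-isSubspace = LinSpan-isSubspace (coords ∘ Ps)
  U-isSubspace = Span-isSubspace (⋃ₚ 𝓑′ ∩ₚ H)

  𝓑∩H⊆U : ∀ R → R ∈ₚ (⋃ₚ 𝓑 ∩ₚ H) → Span (⋃ₚ 𝓑′ ∩ₚ H) (coords R)
  𝓑∩H⊆U R ((i , R∈𝓑ᵢ) , R∈H) =
    Pullback.image-cutting (φ i) (𝓒-cut i) V-isSubspace (LinSpan? (coords ∘ Ps)) (LinSpan-exchange {vs = coords ∘ Ps} ind)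
      U-isSubspace
      (λ P P∈image P∈V → ∈ₚ⇒Span (⋃ₚ 𝓑′ ∩ₚ H) {P} ((i , proj₂ (𝓑′≐ i) {P} P∈image) , V⊆H {P} P∈V))
      -- `R` lies in `⟨ 𝓑 i ⟩`, the image of `φ i`, so `image-cutting` reaches it.
      R (∈ₚ⇒Span (𝓑 i) {R} R∈𝓑ᵢ) (H⊆V {R} R∈H)
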